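{- There is an absolute constant $C$ such that the following holds. Let $k \geq 0$ be an integer. For graphs of odd girth at least $\frac{11}{2}\cdot 5^k + \frac{3}{2}$, there exists a deterministic online coloring algorithm that uses at most $C\,(k+1)\, n^{\frac{2}{k+4}}$ colors, where $n\ge 1$ is the number of vertices of the final graph.
   Context: Graphs are finite, simple and undirected. Online coloring problem: a graph $G=(V,E)$ is initially empty; vertices are added one by one, each together with its edges to previously added vertices. Immediately after a vertex $v$ is added, the algorithm must irrevocably assign a color $c(v)\in\mathbb{N}$ different from the colors of all neighbors of $v$; only then is the next vertex presented. The number of colors used is $|\{c(v): v\in V\}|$. The number $n$ of vertices of the final graph is assumed to be known to the algorithm in advance. An algorithm "for graphs of odd girth at least $g$" has to work on every online input whose final graph has odd girth at least $g$. The odd girth of a graph is the length of its shortest odd-length cycle, or $+\infty$ if there is none (equivalently, the length of its shortest odd-length closed walk). -}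

module Defs where

open import Data.Empty using (⊥)
open import Data.Fin.Base using (Fin; zero; suc)
open import Data.Fin.Subset using (Subset; _∈_)
open import Data.List.Base using (List; _∷_; _∷ʳ_; length; deduplicate)
open import Data.List.Relation.Unary.Linked using (Linked)
open import Data.List.Relation.Unary.Unique.Propositional using (Unique)
open import Data.Nat.Base using (ℕ; zero; suc; _*_; _^_; _≤_; NonZero)
open import Data.Nat.Divisibility using (_∣_)
open import Data.Nat.Properties using (_≟_)
open import Data.Vec.Base using (Vec; []; _∷_; lookup; toList)
open import Level using (0ℓ)
open import Relation.Binary.Core using (Rel)
open import Relation.Binary.Definitions using (Symmetric; Irreflexive)
open import Relation.Binary.PropositionalEquality using (_≡_; _≢_; refl)
open import Relation.Nullary.Negation using (¬_)

record Graph (n : ℕ) : Set₁ where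
  field
    _~_      : Rel (Fin n) 0ℓ
    ~-sym    : Symmetric _~_
    ~-irrefl : Irreflexive _≡_ _~_

-- The cycle v, v₁, …, vₘ, v, where others = v₁, …, vₘ; its length is 1 + m.
record Cycle {n : ℕ} (G : Graph n) : Set where
  open Graph G
  field
    start    : Fin n
    others   : List (Fin n)
    distinct : Unique (start ∷ others)
    linked   : Linked _~_ (start ∷ (others ∷ʳ start))

  len : ℕ
  len = length (start ∷ others)

  field
    3≤len : 3 ≤ len

-- Vacuously true for every g when there is no odd cycle (odd girth +∞).
OddGirth≥ : {n : ℕ} → Graph n → ℕ → Set
OddGirth≥ G g = (c : Cycle G) → ¬ (2 ∣ Cycle.len c) → g ≤ Cycle.len c

Coloring : ℕ → Set
Coloring n = Vec ℕ n

Proper : {n : ℕ} → Graph n → Coloring n → Set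
Proper G c = ∀ {u v} → u ~ v → lookup c u ≢ lookup c v
  where open Graph G

colorsUsed : {n : ℕ} → Coloring n → ℕ
colorsUsed c = length (deduplicate _≟_ (toList c))

-- An online input: P ▷ N adds a new vertex to P, adjacent to exactly the
-- vertices in N.  The newest vertex is numbered zero and the earlier ones are
-- shifted by suc, so vertices (and entries of a coloring) are indexed from the
-- most recent to the oldest.
infixl 5 _▷_

data Presentation : ℕ → Set where
  ∅   : Presentation 0
  _▷_ : {n : ℕ} → Presentation n → Subset n → Presentation (suc n)

Adj : {n : ℕ} → Presentation n → Rel (Fin n) 0ℓ
Adj (P ▷ N) zero    zero    = ⊥
Adj (P ▷ N) zero    (suc v) = v ∈ N
Adj (P ▷ N) (suc u) zero    = u ∈ N
Adj (P ▷ N) (suc u) (suc v) = Adj P u v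

Adj-sym : {n : ℕ} (P : Presentation n) → Symmetric (Adj P)
Adj-sym (P ▷ N) {zero}  {suc v} a = a
Adj-sym (P ▷ N) {suc u} {zero}  a = a
Adj-sym (P ▷ N) {suc u} {suc v} a = Adj-sym P a

Adj-irrefl : {n : ℕ} (P : Presentation n) → Irreflexive _≡_ (Adj P)
Adj-irrefl (P ▷ N) {suc u} refl a = Adj-irrefl P refl a

finalGraph : {n : ℕ} → Presentation n → Graph n
finalGraph P = record
  { _~_      = Adj P
  ; ~-sym    = Adj-sym P
  ; ~-irrefl = Adj-irrefl P
  }

-- A deterministic algorithm chooses the color of the newest vertex from the
-- announced final number of vertices, everything presented so far (including
-- the newest vertex and its edges), and the colors already assigned.
OnlineAlgorithm : Set
OnlineAlgorithm = (n : ℕ) {i : ℕ} → Presentation (suc i) → Coloring i → ℕ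

run : OnlineAlgorithm → (n : ℕ) {i : ℕ} → Presentation i → Coloring i
run A n ∅       = []
run A n (P ▷ N) = A n (P ▷ N) c ∷ c
  where c = run A n P

infix 4 _≤_·_^⟨_/_⟩

-- m ≤ a · x^(p/q) over the reals, with both (nonnegative) sides raised to the
-- q-th power.
_≤_·_^⟨_/_⟩ : (m a x p q : ℕ) .{{_ : NonZero q}} → Set
m ≤ a · x ^⟨ p / q ⟩ = m ^ q ≤ a ^ q * x ^ p

{-# OPTIONS --safe #-}

-- The algorithm works in k + 2 levels with x² colours each, where x is about n^(1/(k+4)).
-- At every level the vertices form clusters (single vertices at level 0); clusters are
-- neighbours if an edge joins them.  A cluster with fewer than T neighbours colours its
-- newest vertex with its current colour, and each time it gains a neighbour it replaces this
-- colour by one which its neighbours have not used.  A cluster with at least T neighbours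
-- passes the vertex to the next level, where it joins a root cluster with which it shares a
-- neighbour, or becomes a root itself.  Roots have disjoint sets of at least T neighbours, so
-- the number of clusters drops by a factor T: with T = x² at level 0 and T = x at levels
-- 1, …, k at most x² clusters are left, and each of them gets a colour of its own.
-- Two vertices of one cluster at level j are joined by an even walk shorter than 5ʲ; if they
-- were adjacent, there would be an odd cycle of length at most 5ʲ ≤ 5ᵏ⁺¹, below the odd girth.

module Submission where

open import Data.Fin.Base using (Fin; zero; suc)
open import Data.Fin.Properties using () renaming (any? to anyᶠ?; _≟_ to _≟ᶠ_)
open import Data.Fin.Subset using (Subset)
open import Data.Fin.Subset.Properties using () renaming (_∈?_ to _∈ˢ?_)
open import Data.List.Base
  using (List; []; _∷_; _++_; length; _∷ʳ_; upTo; map; filter; concat; concatMap; catMaybes;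
    deduplicate)
open import Data.List.Membership.Propositional using (_∈_; _∉_; find)
open import Data.List.Membership.Propositional.Properties
  using (∈-∃++; ∈-++⁺ˡ; ∈-++⁺ʳ; ∈-++⁻; ∈-concat⁻′; ∈-concatMap⁺; ∈-deduplicate⁺; ∈-deduplicate⁻;
    ∈-filter⁺; ∈-filter⁻; ∈-map⁺; ∈-map⁻; ∈-upTo⁺; ∈-upTo⁻)
open import Data.List.Properties
  using (filter-accept; filter-none; filter-reject; length-++; length-map; length-upTo)
open import Data.List.Relation.Binary.Disjoint.Propositional using (Disjoint)
open import Data.List.Relation.Binary.Subset.Propositional using (_⊆_)
open import Data.List.Relation.Unary.All as All using (All; []; _∷_)
open import Data.List.Relation.Unary.All.Properties using (¬Any⇒All¬)
open import Data.List.Relation.Unary.AllPairs using (AllPairs; []; _∷_)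
open import Data.List.Relation.Unary.Any as Any using (any?; here; there)
open import Data.List.Relation.Unary.Linked using (Linked; [-]; _∷_)
open import Data.List.Relation.Unary.Unique.Propositional using (Unique)
open import Data.List.Relation.Unary.Unique.Propositional.Properties using (concat⁺; upTo⁺)
open import Data.Maybe.Base using (Maybe; just; nothing; fromMaybe)
open import Data.Maybe.Properties using (just-injective) renaming (≡-dec to ≡-decᵐ)
open import Data.Nat.Base
  using (ℕ; zero; suc; pred; _+_; _*_; _^_; _≤_; _<_; _≥_; z≤n; s≤s; z<s; s≤s⁻¹; >-nonZero)
open import Data.Nat.Divisibility using (_∣_; _∣?_; divides; ∣m∣n⇒∣m+n; ∣m+n∣m⇒∣n; ∣⇒≤)
open import Data.Nat.DivMod using (_/_; m*n/n≡m; /-monoˡ-≤)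
open import Data.Nat.Induction using (<-rec)
open import Data.Nat.Properties
open import Data.Nat.Tactic.RingSolver using (solve-∀)
open import Data.Product.Base using (Σ-syntax; ∃-syntax; _×_; _,_; proj₁; proj₂)
open import Data.Sum.Base using (_⊎_; inj₁; inj₂; [_,_]′; map₂)
open import Data.Vec.Base as Vec using (Vec; []; _∷_; lookup; toList; zipWith)
open import Data.Vec.Membership.Propositional.Properties using (∈-toList⁻)
open import Data.Vec.Properties using (lookup-map; lookup-zipWith)
open import Data.Vec.Relation.Unary.Any using (index)
open import Data.Vec.Relation.Unary.Any.Properties using (lookup-index)
open import Relation.Binary.Definitions using (DecidableEquality)
open import Relation.Binary.PropositionalEquality
  using (_≡_; _≢_; refl; sym; trans; cong; subst; ≢-sym)
open import Relation.Nullary.Decidable using (Dec; yes; no; decidable-stable; ¬?; _×-dec_)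
open import Relation.Nullary.Negation using (¬_; contradiction)
open import Data.List.Membership.DecPropositional _≟_ using (_∈?_)
open import Data.List.Relation.Unary.Unique.DecPropositional.Properties _≟_ using (deduplicate-!)
open import Defs

-- Repetition-free lists and the pigeonhole principle.

module _ {A : Set} where

  length-⊆ : {xs ys : List A} → Unique xs → xs ⊆ ys → length xs ≤ length ys
  length-⊆ []          _   = z≤n
  length-⊆ {x ∷ xs} (x∉ ∷ xs!) sub with ∈-∃++ (sub (here refl))
  ... | as , bs , refl = begin
    suc (length xs)            ≤⟨ s≤s (length-⊆ xs! sub′) ⟩
    suc (length (as ++ bs))    ≡⟨ cong suc (length-++ as) ⟩
    suc (length as + length bs) ≡⟨ +-suc (length as) (length bs) ⟨
    length as + suc (length bs) ≡⟨ length-++ as ⟨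
    length (as ++ x ∷ bs)      ∎
    where
    open ≤-Reasoning
    sub′ : xs ⊆ as ++ bs
    sub′ y∈ with ∈-++⁻ as (sub (there y∈))
    ... | inj₁ y∈as          = ∈-++⁺ˡ y∈as
    ... | inj₂ (here refl)   = contradiction refl (All.lookup x∉ y∈)
    ... | inj₂ (there y∈bs)  = ∈-++⁺ʳ as y∈bs

  module _ (_≟′_ : DecidableEquality A) where

    -- An element of `ys` outside `xs` could be put in front of `xs`, giving a repetition-free list
    -- inside `ys` that is too long.
    ⊆-reverse : {xs ys : List A} → Unique xs → xs ⊆ ys → length ys ≤ length xs → ys ⊆ xs
    ⊆-reverse {xs} {ys} xs! sub len {y} y∈ with any? (y ≟′_) xs
    ... | yes y∈xs = y∈xs
    ... | no y∉xs  = contradiction (length-⊆ (¬Any⇒All¬ xs y∉xs ∷ xs!) sub′) (≤⇒≯ len)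
      where
      sub′ : y ∷ xs ⊆ ys
      sub′ (here refl) = y∈
      sub′ (there z∈)  = sub z∈

bounded-length : ∀ {xs m} → Unique xs → (∀ {x} → x ∈ xs → x < m) → length xs ≤ m
bounded-length {xs} {m} xs! xs<m =
  subst (length xs ≤_) (length-upTo m) (length-⊆ xs! λ x∈ → ∈-upTo⁺ (xs<m x∈))

-- Pigeonhole: the `suc (length xs)` numbers up to `length xs` cannot all occur in `xs`. The bound
-- on `c` is what limits the palette of a level.
mex : (xs : List ℕ) → ∃[ c ] (c ∉ xs × c ≤ length xs)
mex xs with any? (λ c → ¬? (c ∈? xs)) (upTo (suc (length xs)))
... | yes some with find some
...   | c , c∈ , c∉xs = c , c∉xs , s≤s⁻¹ (∈-upTo⁻ c∈)
mex xs | no none = contradiction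
  (subst (_≤ length xs) (length-upTo (suc (length xs))) (length-⊆ (upTo⁺ _) upTo⊆xs))
  (<⇒≱ ≤-refl)
  where
  upTo⊆xs : upTo (suc (length xs)) ⊆ xs
  upTo⊆xs {c} c∈ = decidable-stable (c ∈? xs) (All.lookup (¬Any⇒All¬ _ none) c∈)

length-concatMap-≤ : ∀ {A B : Set} {f : A → List B} {h} (xs : List A) →
  (∀ x → length (f x) ≤ h) → length (concatMap f xs) ≤ length xs * h
length-concatMap-≤ []           f≤h = z≤n
length-concatMap-≤ {f = f} (x ∷ xs) f≤h =
  ≤-trans (≤-reflexive (length-++ (f x))) (+-mono-≤ (f≤h x) (length-concatMap-≤ xs f≤h))

-- Walks

module _ {n : ℕ} (G : Graph n) where
  open Graph G

  data Walk : ℕ → Fin n → Fin n → Set where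
    []  : ∀ {u} → Walk 0 u u
    _∷_ : ∀ {u v w ℓ} → u ~ w → Walk ℓ w v → Walk (suc ℓ) u v

  NoOddWalk≤ : ℕ → Set
  NoOddWalk≤ s = ∀ {ℓ u} → Walk ℓ u u → ¬ 2 ∣ ℓ → ¬ ℓ ≤ s

  -- The strict bound makes `Near 1` mean equality, and leaves room for the connecting edges when
  -- walks are chained.
  Near : ℕ → Fin n → Fin n → Set
  Near s u v = ∃[ ℓ ] (Walk ℓ u v × 2 ∣ ℓ × ℓ < s)

module _ {n : ℕ} {G : Graph n} where
  open Graph G

  infixr 5 _++ʷ_
  _++ʷ_ : ∀ {a b u v w} → Walk G a u v → Walk G b v w → Walk G (a + b) u w
  []      ++ʷ q = q
  (e ∷ p) ++ʷ q = e ∷ (p ++ʷ q)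

  -- The last vertex is left out.
  vertices : ∀ {ℓ u v} → Walk G ℓ u v → List (Fin n)
  vertices []              = []
  vertices (_∷_ {u = u} e p) = u ∷ vertices p

  length-vertices : ∀ {ℓ u v} (p : Walk G ℓ u v) → length (vertices p) ≡ ℓ
  length-vertices []      = refl
  length-vertices (e ∷ p) = cong suc (length-vertices p)

  linked-vertices : ∀ {ℓ u v} (p : Walk G ℓ u v) → Linked _~_ (vertices p ∷ʳ v)
  linked-vertices []            = [-]
  linked-vertices (e ∷ [])      = e ∷ [-]
  linked-vertices (e ∷ e′ ∷ p)  = e ∷ linked-vertices (e′ ∷ p)

  -- The second part is nonempty because `vertices` leaves out the last vertex.
  splitAt : ∀ {ℓ u v w} (p : Walk G ℓ u v) → w ∈ vertices p →
    ∃[ a ] ∃[ b ] (Walk G a u w × Walk G (suc b) w v × a + suc b ≡ ℓ)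
  splitAt (_∷_ {ℓ = ℓ} e p) (here refl) = 0 , ℓ , [] , e ∷ p , refl
  splitAt (e ∷ p) (there w∈) with splitAt p w∈
  ... | a , b , q , r , refl = suc a , b , e ∷ q , r , refl

  -- Both the loop at `w` and the part after it are nonempty, so the loop alone and the walk without
  -- it are each strictly shorter than the whole.
  Loop : ℕ → (u v : Fin n) → Set
  Loop ℓ u v = ∃[ w ] ∃[ a ] ∃[ b ] ∃[ c ]
    (Walk G a u w × Walk G (suc b) w w × Walk G (suc c) w v × a + (suc b + suc c) ≡ ℓ)

  unique⊎loop : ∀ {ℓ u v} (p : Walk G ℓ u v) → Unique (vertices p) ⊎ Loop ℓ u v
  unique⊎loop []      = inj₁ []
  unique⊎loop {u = u} (e ∷ p) with unique⊎loop p
  ... | inj₂ (w , a , b , c , q , r , s , refl) = inj₂ (w , suc a , b , c , e ∷ q , r , s , refl)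
  ... | inj₁ p! with any? (u ≟ᶠ_) (vertices p)
  ...   | no u∉ = inj₁ (¬Any⇒All¬ _ u∉ ∷ p!)
  ...   | yes u∈ with splitAt p u∈
  ...     | b , c , q , r , refl = inj₂ (u , 0 , b , c , [] , e ∷ q , r , refl)

  -- A repeated vertex splits a closed walk into two shorter ones, one of which is odd.
  oddClosedWalk⇒oddCycle : ∀ {ℓ u} → Walk G ℓ u u → ¬ 2 ∣ ℓ →
    Σ[ c ∈ Cycle G ] (¬ 2 ∣ Cycle.len c × Cycle.len c ≤ ℓ)
  oddClosedWalk⇒oddCycle {ℓ} = <-rec Goal step ℓ
    where
    Goal : ℕ → Set
    Goal ℓ = ∀ {u} → Walk G ℓ u u → ¬ 2 ∣ ℓ → Σ[ c ∈ Cycle G ] (¬ 2 ∣ Cycle.len c × Cycle.len c ≤ ℓ)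
    shorter : ∀ {ℓ ℓ′} → ℓ′ < ℓ → Σ[ c ∈ Cycle G ] (¬ 2 ∣ Cycle.len c × Cycle.len c ≤ ℓ′) →
      Σ[ c ∈ Cycle G ] (¬ 2 ∣ Cycle.len c × Cycle.len c ≤ ℓ)
    shorter ℓ′<ℓ (c , odd , c≤) = c , odd , ≤-trans c≤ (<⇒≤ ℓ′<ℓ)
    step : ∀ ℓ → (∀ {ℓ′} → ℓ′ < ℓ → Goal ℓ′) → Goal ℓ
    step ℓ rec p odd with unique⊎loop p
    step ℓ rec p odd | inj₂ (w , a , b , c , q , r , s , refl) with 2 ∣? suc b
    ... | no  odd-b  = shorter b<ℓ (rec b<ℓ r odd-b)
      where
      b<ℓ : suc b < a + (suc b + suc c)
      b<ℓ = ≤-trans (m<m+n (suc b) z<s) (m≤n+m _ a)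
    ... | yes even-b = shorter ac<ℓ (rec ac<ℓ (q ++ʷ s) λ even-ac →
        odd (subst (2 ∣_) (eq a b c) (∣m∣n⇒∣m+n even-b even-ac)))
      where
      eq : ∀ a b c → suc b + (a + suc c) ≡ a + (suc b + suc c)
      eq = solve-∀
      ac<ℓ : a + suc c < a + (suc b + suc c)
      ac<ℓ = +-monoʳ-< a (m<n+m (suc c) z<s)
    -- No vertex repeats. Lengths 0 and 2 are even and length 1 contradicts irreflexivity, so what
    -- remains is a cycle of length at least 3.
    step _ rec [] odd | inj₁ p! = contradiction (divides 0 refl) odd
    step _ rec (e ∷ []) odd | inj₁ p! = contradiction e (~-irrefl refl)
    step _ rec (e ∷ e′ ∷ []) odd | inj₁ p! = contradiction (divides 1 refl) odd
    step (suc ℓ) rec (_∷_ {u = u} e p@(_ ∷ _ ∷ _)) odd | inj₁ p! =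
      cycle , subst (λ m → ¬ 2 ∣ m) (sym len≡) odd , ≤-reflexive len≡
      where
      len≡ : suc (length (vertices p)) ≡ suc ℓ
      len≡ = cong suc (length-vertices p)
      cycle : Cycle G
      cycle = record
        { start = u ; others = vertices p ; distinct = p!
        ; linked = linked-vertices (e ∷ p) ; 3≤len = s≤s (s≤s (s≤s z≤n)) }

  oddGirth⇒noOddWalk : ∀ {g s} → OddGirth≥ G g → s < g → NoOddWalk≤ G s
  oddGirth⇒noOddWalk girth s<g p odd ℓ≤s with oddClosedWalk⇒oddCycle p odd
  ... | c , c-odd , c≤ = <⇒≱ s<g (≤-trans (girth c c-odd) (≤-trans c≤ ℓ≤s))

  -- The two connecting edges preserve parity, and their length 2 is absorbed when three strict
  -- bounds are merged into one.
  near-trans : ∀ {s t r u p q q′ p′ v} → Near G s u p → p ~ q → Near G t q q′ → q′ ~ p′ → Near G r p′ v →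
    Near G (s + (t + r)) u v
  near-trans {s} {t} {r} (a , w , 2∣a , a<) e (b , x , 2∣b , b<) f (c , y , 2∣c , c<) =
    a + suc (b + suc c) , w ++ʷ e ∷ x ++ʷ f ∷ y
    , subst (2 ∣_) (eq a b c) (∣m∣n⇒∣m+n 2∣a (∣m∣n⇒∣m+n 2∣b (∣m∣n⇒∣m+n (divides 1 refl) 2∣c)))
    , subst (_≤ s + (t + r)) (eq′ a b c) (+-mono-≤ a< (+-mono-≤ b< c<))
    where
    eq : ∀ a b c → a + (b + (2 + c)) ≡ a + suc (b + suc c)
    eq = solve-∀
    eq′ : ∀ a b c → suc a + (suc b + suc c) ≡ suc (a + suc (b + suc c))
    eq′ = solve-∀

  -- The edge would close the even walk to an odd closed walk of length at most `s`.
  near-not-adjacent : ∀ {s u v} → NoOddWalk≤ G s → Near G s u v → ¬ v ~ u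
  near-not-adjacent none (ℓ , p , 2∣ℓ , ℓ<s) e = none (e ∷ p) odd ℓ<s
    where
    odd : ¬ 2 ∣ suc ℓ
    odd 2∣sℓ = contradiction (∣m+n∣m⇒∣n (subst (2 ∣_) (+-comm 1 ℓ) 2∣sℓ) 2∣ℓ) λ 2∣1 → <⇒≱ ≤-refl (∣⇒≤ 2∣1)

-- Powers and roots

^-distribʳ-* : ∀ q a b → (a * b) ^ q ≡ a ^ q * b ^ q
^-distribʳ-* zero    a b = refl
^-distribʳ-* (suc q) a b = trans (cong (a * b *_) (^-distribʳ-* q a b)) (interchange a b (a ^ q) (b ^ q))
  where
  interchange : ∀ a b c d → a * b * (c * d) ≡ a * c * (b * d)
  interchange = solve-∀

-- Induction on `n`: `x` is kept until its power becomes too small. Then `suc x` is large enough,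
-- and `suc x ≤ 2 * x` gives the upper bound.
integerRoot : ∀ q n → 1 ≤ q → ∃[ x ] (1 ≤ x × suc n ≤ x ^ q × x ^ q ≤ 2 ^ q * suc n)
integerRoot q zero    1≤q = 1 , ≤-refl , ≤-reflexive (sym (^-zeroˡ q)) ,
  subst (_≤ 2 ^ q * 1) (sym (^-zeroˡ q)) (≤-trans (m^n>0 2 q) (≤-reflexive (sym (*-identityʳ _))))
integerRoot q (suc m) 1≤q with integerRoot q m 1≤q
... | x , 1≤x , n≤ , ≤n with suc (suc m) ≤? x ^ q
...   | yes 1+n≤ = x , 1≤x , 1+n≤ , ≤-trans ≤n (*-monoʳ-≤ (2 ^ q) (n≤1+n (suc m)))
...   | no  1+n≰ = suc x , s≤s z≤n , 1+n≤ , ≤1+n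
  where
  open ≤-Reasoning
  x^q≤n : x ^ q ≤ suc m
  x^q≤n = s≤s⁻¹ (≰⇒> 1+n≰)
  1+n≤ : suc (suc m) ≤ suc x ^ q
  1+n≤ = ≤-<-trans n≤ (^-monoˡ-< q ⦃ >-nonZero 1≤q ⦄ (n<1+n x))
  ≤1+n : suc x ^ q ≤ 2 ^ q * suc (suc m)
  ≤1+n = begin
    suc x ^ q      ≤⟨ ^-monoˡ-≤ q (+-monoˡ-≤ x 1≤x) ⟩
    (x + x) ^ q    ≡⟨ cong (λ y → (x + y) ^ q) (+-identityʳ x) ⟨
    (2 * x) ^ q    ≡⟨ ^-distribʳ-* q 2 x ⟩
    2 ^ q * x ^ q  ≤⟨ *-monoʳ-≤ (2 ^ q) (≤-trans x^q≤n (n≤1+n (suc m))) ⟩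
    2 ^ q * suc (suc m)  ∎

-- Numbered lists and overlapping sets.

-- x is the entry at position b, counted from the end of the list.
data Indexed {A : Set} : List A → ℕ → A → Set where
  here  : ∀ {x xs} → Indexed (x ∷ xs) (length xs) x
  there : ∀ {x y xs b} → Indexed xs b x → Indexed (y ∷ xs) b x

module _ {A : Set} where

  indexed-< : ∀ {xs : List A} {b x} → Indexed xs b x → b < length xs
  indexed-< here      = ≤-refl
  indexed-< (there i) = m≤n⇒m≤1+n (indexed-< i)

  indexed-functional : ∀ {xs : List A} {b x y} → Indexed xs b x → Indexed xs b y → x ≡ y
  indexed-functional here      here      = refl
  indexed-functional here      (there j) = contradiction (indexed-< j) (<-irrefl refl)
  indexed-functional (there i) here      = contradiction (indexed-< i) (<-irrefl refl)
  indexed-functional (there i) (there j) = indexed-functional i j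

  indexed⇒∈ : ∀ {xs : List A} {b x} → Indexed xs b x → x ∈ xs
  indexed⇒∈ here      = here refl
  indexed⇒∈ (there i) = there (indexed⇒∈ i)

findOverlap : (B : List ℕ) (Fs : List (List ℕ)) →
  (∃[ b ] ∃[ F ] ∃[ u ] (Indexed Fs b F × u ∈ F × u ∈ B)) ⊎ All (Disjoint B) Fs
findOverlap B []       = inj₂ []
findOverlap B (F ∷ Fs) with any? (_∈? B) F
... | yes some with find some
...   | u , u∈F , u∈B = inj₁ (length Fs , F , u , here , u∈F , u∈B)
findOverlap B (F ∷ Fs) | no none with findOverlap B Fs
... | inj₁ (b , F′ , u , i , u∈F , u∈B) = inj₁ (b , F′ , u , there i , u∈F , u∈B)
... | inj₂ disj = inj₂ ((λ (u∈B , u∈F) → All.lookup (¬Any⇒All¬ F none) u∈F u∈B) ∷ disj)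

-- One level of the algorithm

record Network : Set where
  no-eta-equality
  field
    nbrs   : ℕ → List ℕ
    unique : ∀ a → Unique (nbrs a)
    symm   : ∀ {a u} → u ∈ nbrs a → a ∈ nbrs u
    irrefl : ∀ {a} → a ∉ nbrs a

-- colour is what the cluster uses while it has exactly stage neighbours.
record Phase : Set where
  constructor phase
  field
    cluster stage colour : ℕ

open Phase

phasesOf : ℕ → List Phase → List Phase
phasesOf u = filter (λ p → cluster p ≟ u)

-- A cluster with T neighbours gets no further colours, and no cluster gets more than h.
-- A root is stored as its set of neighbours.
record Ledger (T h : ℕ) (N : Network) : Set where
  open Network N
  field
    phases : List Phase
    roots  : List (List ℕ)

    stage≤   : ∀ {p} → p ∈ phases → stage p ≤ length (nbrs (cluster p))
    stage<   : ∀ {p} → p ∈ phases → stage p < T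
    colour<  : ∀ {p} → p ∈ phases → colour p < T * h
    stages!  : ∀ u → Unique (map stage (phasesOf u phases))
    few      : ∀ u → length (phasesOf u phases) ≤ h
    -- The equation says that p is still in use.
    distinct : ∀ {p q} → p ∈ phases → q ∈ phases → stage p ≡ length (nbrs (cluster p)) →
      cluster q ∈ nbrs (cluster p) → colour p ≢ colour q

    roots!         : All Unique roots
    roots-large    : All (λ F → T ≤ length F) roots
    roots-local    : All (λ F → ∃[ r ] F ⊆ nbrs r) roots
    roots-disjoint : AllPairs Disjoint roots

open Ledger

emptyLedger : ∀ {T h N} → Ledger T h N
emptyLedger = record
  { phases = [] ; roots = [] ; stage≤ = λ () ; stage< = λ () ; colour< = λ () ; stages! = λ _ → []
  ; few = λ _ → z≤n ; distinct = λ () ; roots! = [] ; roots-large = [] ; roots-local = []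
  ; roots-disjoint = [] }

_⊑_ : Network → Network → Set
N ⊑ N′ = ∀ {a} → Network.nbrs N a ⊆ Network.nbrs N′ a

-- Root numbers serve as labels at the next level. Being counted from the end, they survive when a
-- new root is put in front.
record Extends {T h N} (a : ℕ) (L L′ : Ledger T h N) : Set where
  field
    phases⊆ : phases L ⊆ phases L′
    roots⊆  : ∀ {b F} → Indexed (roots L) b F → Indexed (roots L′) b F
    origin  : ∀ {p} → p ∈ phases L′ → p ∈ phases L ⊎ cluster p ≡ a

open Extends

extends-refl : ∀ {T h N a} {L : Ledger T h N} → Extends a L L
extends-refl = record { phases⊆ = λ p∈ → p∈ ; roots⊆ = λ i → i ; origin = inj₁ }

-- Roots keep the neighbour set they were created with, so growth of the network affects only the
-- bound on stages, `roots-local` and `distinct`. The first two are monotone.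
enlarge : ∀ {T h N N′} → N ⊑ N′ → Ledger T h N → Ledger T h N′
enlarge {T} {h} {N} {N′} N⊑N′ L = record
  { phases = phases L ; roots = roots L
  ; stage≤ = λ {p} p∈ → ≤-trans (stage≤ L p∈) (grows (cluster p))
  ; stage< = stage< L ; colour< = colour< L ; stages! = stages! L ; few = few L
  ; distinct = distinct′
  ; roots! = roots! L ; roots-large = roots-large L
  ; roots-local = All.map (λ (r , F⊆) → r , λ {_} u∈ → N⊑N′ (F⊆ u∈)) (roots-local L)
  ; roots-disjoint = roots-disjoint L }
  where
  open Network
  grows : ∀ a → length (nbrs N a) ≤ length (nbrs N′ a)
  grows a = length-⊆ (unique N a) N⊑N′
  -- A phase that is still current has seen no new neighbours.
  distinct′ : ∀ {p q} → p ∈ phases L → q ∈ phases L → stage p ≡ length (nbrs N′ (cluster p)) →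
    cluster q ∈ nbrs N′ (cluster p) → colour p ≢ colour q
  distinct′ {p} p∈ q∈ current q~ = distinct L p∈ q∈
    (≤-antisym (stage≤ L p∈) (≤-trans (grows (cluster p)) (≤-reflexive (sym current))))
    (⊆-reverse _≟_ (unique N (cluster p)) N⊑N′
      (≤-trans (≤-reflexive (sym current)) (stage≤ L p∈)) q~)

module _ {T h : ℕ} {N : Network} (L : Ledger T h N) (a : ℕ) where
  open Network N

  -- Why a gets at most h colours: its stages are below T ≤ h, or it has no phase yet.
  Room : Set
  Room = T ≤ h ⊎ (1 ≤ h × (∀ {p} → p ∈ phases L → cluster p ≢ a))

  module _ (small : length (nbrs a) < T) (room : Room) where
    private
      -- Replaced colours of the neighbours are included, since older vertices still carry them.
      forbidden : List ℕ
      forbidden = concatMap (λ u → map colour (phasesOf u (phases L))) (nbrs a)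

      length-forbidden : length forbidden ≤ length (nbrs a) * h
      length-forbidden = length-concatMap-≤ (nbrs a) λ u →
        ≤-trans (≤-reflexive (length-map colour (phasesOf u (phases L)))) (few L u)

      forbidden⁺ : ∀ {q} → q ∈ phases L → cluster q ∈ nbrs a → colour q ∈ forbidden
      forbidden⁺ q∈ u∈ = ∈-concatMap⁺ _ (Any.map
        (λ { refl → ∈-map⁺ colour (∈-filter⁺ (λ p → cluster p ≟ _) q∈ refl) }) u∈)

      1≤h : 1 ≤ h
      1≤h = [ ≤-trans (≤-trans (s≤s z≤n) small) , proj₁ ]′ room

    -- Fewer than `T` neighbours with at most `h` colours each forbid fewer than `T * h` colours, so
    -- `mex` finds a free one below `T * h`.
    openPhase : (∀ {p} → p ∈ phases L → cluster p ≡ a → stage p ≢ length (nbrs a)) →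
      Σ[ p ∈ Phase ] Σ[ L′ ∈ Ledger T h N ]
        (Extends a L L′ × p ∈ phases L′ × cluster p ≡ a × stage p ≡ length (nbrs a))
    openPhase stale with mex forbidden
    ... | c , c∉ , c≤ = p₀ , L′ , extends , here refl , refl , refl
      where
      p₀ : Phase
      p₀ = phase a (length (nbrs a)) c

      c< : c < T * h
      c< = begin-strict
        c                                ≤⟨ c≤ ⟩
        length forbidden                 ≤⟨ length-forbidden ⟩
        length (nbrs a) * h              <⟨ *-monoˡ-< h ⦃ >-nonZero 1≤h ⦄ small ⟩
        T * h                            ∎
        where open ≤-Reasoning

      stages!′ : ∀ u → Unique (map stage (phasesOf u (p₀ ∷ phases L)))
      stages!′ u with a ≟ u
      ... | no  a≢u = subst (λ ps → Unique (map stage ps))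
              (sym (filter-reject (λ p → cluster p ≟ u) {xs = phases L} a≢u)) (stages! L u)
      ... | yes refl = subst (λ ps → Unique (map stage ps))
              (sym (filter-accept (λ p → cluster p ≟ a) {xs = phases L} refl))
              (All.tabulate new ∷ stages! L a)
        where
        new : ∀ {m} → m ∈ map stage (phasesOf a (phases L)) → length (nbrs a) ≢ m
        new m∈ eq with ∈-map⁻ stage m∈
        ... | p , p∈ , refl with ∈-filter⁻ (λ p → cluster p ≟ a) {xs = phases L} p∈
        ...   | p∈′ , refl = stale p∈′ refl (sym eq)

      stage<′ : ∀ {p} → p ∈ p₀ ∷ phases L → stage p < T
      stage<′ (here refl) = small
      stage<′ (there p∈)  = stage< L p∈

      few′ : Room → ∀ u → length (phasesOf u (p₀ ∷ phases L)) ≤ h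
      few′ (inj₁ T≤h) u = ≤-trans
              (subst (_≤ T) (length-map stage (phasesOf u (p₀ ∷ phases L)))
                (bounded-length (stages!′ u) stages<))
              T≤h
        where
        stages< : ∀ {m} → m ∈ map stage (phasesOf u (p₀ ∷ phases L)) → m < T
        stages< m∈ with ∈-map⁻ stage m∈
        ... | p , p∈ , refl = stage<′ (proj₁ (∈-filter⁻ (λ p → cluster p ≟ u) {xs = p₀ ∷ phases L} p∈))
      few′ (inj₂ (1≤h , fresh)) u with a ≟ u
      ... | no  a≢u = subst (λ ps → length ps ≤ h)
                (sym (filter-reject (λ p → cluster p ≟ u) {xs = phases L} a≢u)) (few L u)
      ... | yes refl = subst (λ ps → length ps ≤ h)
                (sym (trans (filter-accept (λ p → cluster p ≟ a) {xs = phases L} refl)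
                  (cong (p₀ ∷_) (filter-none (λ p → cluster p ≟ a) (All.tabulate fresh)))))
                1≤h

      distinct′ : ∀ {p q} → p ∈ p₀ ∷ phases L → q ∈ p₀ ∷ phases L →
        stage p ≡ length (nbrs (cluster p)) → cluster q ∈ nbrs (cluster p) → colour p ≢ colour q
      distinct′ (here refl) (here refl) _ q~ _ = irrefl q~
      distinct′ (here refl) (there q∈)  _ q~ refl = c∉ (forbidden⁺ q∈ q~)
      -- By symmetry the cluster of `p` is a neighbour of `a`, so `colour p` was forbidden too.
      distinct′ (there p∈)  (here refl) _ q~ refl = c∉ (forbidden⁺ p∈ (symm q~))
      distinct′ (there p∈)  (there q∈)  current q~ = distinct L p∈ q∈ current q~

      L′ : Ledger T h N
      L′ = record
        { phases = p₀ ∷ phases L ; roots = roots L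
        ; stage≤ = λ { (here refl) → ≤-refl ; (there p∈) → stage≤ L p∈ }
        ; stage< = stage<′
        ; colour< = λ { (here refl) → c< ; (there p∈) → colour< L p∈ }
        ; stages! = stages!′ ; few = few′ room ; distinct = distinct′
        ; roots! = roots! L ; roots-large = roots-large L ; roots-local = roots-local L
        ; roots-disjoint = roots-disjoint L }

      extends : Extends a L L′
      extends = record
        { phases⊆ = there ; roots⊆ = λ i → i
        ; origin = λ { (here refl) → inj₂ refl ; (there p∈) → inj₁ p∈ } }

    -- A phase whose stage equals the present number of neighbours is reused; opening one only when
    -- there is none keeps the stages of a cluster distinct.
    currentPhase : Σ[ p ∈ Phase ] Σ[ L′ ∈ Ledger T h N ]
      (Extends a L L′ × p ∈ phases L′ × cluster p ≡ a × stage p ≡ length (nbrs a))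
    currentPhase with any? (λ p → cluster p ≟ a ×-dec stage p ≟ length (nbrs a)) (phases L)
    ... | yes some with find some
    ...   | p , p∈ , p-a , p-cur =
            p , L , extends-refl , p∈ , p-a , p-cur
    currentPhase | no none = openPhase (λ p∈ p-a p-cur → All.lookup (¬Any⇒All¬ _ none) p∈ (p-a , p-cur))

  module _ (1≤T : 1 ≤ T) (large : T ≤ length (nbrs a)) where

    joinRoot : Σ[ L′ ∈ Ledger T h N ] ∃[ b ] ∃[ F ] ∃[ u ]
      (Extends a L L′ × Indexed (roots L′) b F × u ∈ F × u ∈ nbrs a)
    joinRoot with findOverlap (nbrs a) (roots L)
    ... | inj₁ (b , F , u , i , u∈F , u∈) =
          L , b , F , u , extends-refl , i , u∈F , u∈
    ... | inj₂ disj with nbrs a in eq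
    -- By `1 ≤ T` the new root has a neighbour, so it shares one with itself and is treated like any
    -- cluster that joins a root.
    ...   | [] = contradiction (≤-trans 1≤T large) λ ()
    ...   | u ∷ us = L′ , length (roots L) , u ∷ us , u
            , record { phases⊆ = λ p∈ → p∈ ; roots⊆ = there ; origin = inj₁ } , here , here refl , here refl
      where
      L′ : Ledger T h N
      L′ = record
        { phases = phases L ; roots = (u ∷ us) ∷ roots L
        ; stage≤ = stage≤ L ; stage< = stage< L ; colour< = colour< L ; stages! = stages! L
        ; few = few L ; distinct = distinct L
        ; roots! = subst Unique eq (unique a) ∷ roots! L
        ; roots-large = large ∷ roots-large L
        ; roots-local = (a , λ {x} x∈ → subst (x ∈_) (sym eq) x∈) ∷ roots-local L
        ; roots-disjoint = disj ∷ roots-disjoint L }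

-- Labellings and the network of clusters.

-- Labels name clusters; a vertex without a label was coloured at an earlier level.
Labelling : ℕ → Set
Labelling n = Vec (Maybe ℕ) n

adj? : ∀ {n} (P : Presentation n) (u v : Fin n) → Dec (Adj P u v)
adj? (P ▷ N) zero    zero    = no λ ()
adj? (P ▷ N) zero    (suc v) = v ∈ˢ? N
adj? (P ▷ N) (suc u) zero    = u ∈ˢ? N
adj? (P ▷ N) (suc u) (suc v) = adj? P u v

labels : ∀ {n} → Labelling n → List ℕ
labels lab = catMaybes (toList lab)

∈-labels : ∀ {n} (lab : Labelling n) v {a} → lookup lab v ≡ just a → a ∈ labels lab
∈-labels (just a ∷ lab)  zero    refl = here refl
∈-labels (just b ∷ lab)  (suc v) eq   = there (∈-labels lab v eq)
∈-labels (nothing ∷ lab) (suc v) eq   = ∈-labels lab v eq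

module _ {n : ℕ} (P : Presentation n) (lab : Labelling n) where

  Touch : ℕ → ℕ → Set
  Touch a b = a ≢ b × ∃[ u ] ∃[ v ] (lookup lab u ≡ just a × lookup lab v ≡ just b × Adj P u v)

  touch? : ∀ a b → Dec (Touch a b)
  touch? a b = ¬? (a ≟ b) ×-dec anyᶠ? λ u → anyᶠ? λ v →
    ≡-decᵐ _≟_ (lookup lab u) (just a) ×-dec ≡-decᵐ _≟_ (lookup lab v) (just b) ×-dec adj? P u v

  touched : ℕ → List ℕ
  touched a = deduplicate _≟_ (filter (touch? a) (labels lab))

  touched⁺ : ∀ {a b} → Touch a b → b ∈ touched a
  touched⁺ {a} t@(_ , _ , v , _ , v-b , _) =
    ∈-deduplicate⁺ _≟_ (∈-filter⁺ (touch? a) (∈-labels lab v v-b) t)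

  touched⁻ : ∀ {a b} → b ∈ touched a → Touch a b
  touched⁻ {a} b∈ = proj₂ (∈-filter⁻ (touch? a) {xs = labels lab} (∈-deduplicate⁻ _≟_ _ b∈))

  touch-sym : ∀ {a b} → Touch a b → Touch b a
  touch-sym (a≢b , u , v , u-a , v-b , e) = ≢-sym a≢b , v , u , v-b , u-a , Adj-sym P e

  opaque
    network : Network
    network = record
      { nbrs   = touched
      ; unique = λ a → deduplicate-! _
      ; symm   = λ b∈ → touched⁺ (touch-sym (touched⁻ b∈))
      ; irrefl = λ a∈ → proj₁ (touched⁻ a∈) refl }

    nbrs⁺ : ∀ {a b} → Touch a b → b ∈ Network.nbrs network a
    nbrs⁺ = touched⁺

    nbrs⁻ : ∀ {a b} → b ∈ Network.nbrs network a → Touch a b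
    nbrs⁻ = touched⁻

network-⊑ : ∀ {n} (P : Presentation n) lab N l → network P lab ⊑ network (P ▷ N) (l ∷ lab)
network-⊑ P lab N l b∈ with nbrs⁻ P lab b∈
... | a≢b , u , v , u-a , v-b , e = nbrs⁺ (P ▷ N) (l ∷ lab) (a≢b , suc u , suc v , u-a , v-b , e)

-- Processing one vertex at one level.

data Outcome : Set where
  absent   : Outcome
  coloured : (c : ℕ) → Outcome
  passed   : (b : ℕ) → Outcome

-- `passed` records a neighbour `u` common to the cluster and the root; the walks in `next-close`
-- run through it.
data Justified {T h N} (L : Ledger T h N) : Maybe ℕ → Outcome → Set where
  absent   : Justified L nothing absent
  coloured : ∀ {p} → p ∈ phases L → Justified L (just (cluster p)) (coloured (colour p))
  passed   : ∀ {a b u F} → Indexed (roots L) b F → u ∈ F → u ∈ Network.nbrs N a →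
    Justified L (just a) (passed b)

justified-extends : ∀ {T h N a} {L L′ : Ledger T h N} → Extends a L L′ →
  ∀ {l o} → Justified L l o → Justified L′ l o
justified-extends ext absent           = absent
justified-extends ext (coloured p∈)    = coloured (phases⊆ ext p∈)
justified-extends ext (passed i u∈ u~) = passed (roots⊆ ext i) u∈ u~

justified-enlarge : ∀ {T h N N′} {L : Ledger T h N} (N⊑N′ : N ⊑ N′) →
  ∀ {l o} → Justified L l o → Justified (enlarge {N = N} {N′} N⊑N′ L) l o
justified-enlarge N⊑N′ absent           = absent
justified-enlarge N⊑N′ (coloured p∈)    = coloured p∈
justified-enlarge N⊑N′ (passed i u∈ u~) = passed i u∈ (N⊑N′ u~)

-- `proper` exempts edges inside a cluster, so a level can be built for every presentation; the odd
-- girth is brought in later, by `close⇒≢`.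
record Level (T h : ℕ) {n : ℕ} (P : Presentation n) (lab : Labelling n) (out : Vec Outcome n) : Set where
  field
    ledger    : Ledger T h (network P lab)
    justified : ∀ v → Justified ledger (lookup lab v) (lookup out v)
    occurs    : ∀ {p} → p ∈ phases ledger → ∃[ v ] lookup lab v ≡ just (cluster p)
    proper    : ∀ {u v c} → Adj P u v → lookup lab u ≢ lookup lab v →
      lookup out u ≡ coloured c → lookup out v ≢ coloured c

open Level

emptyLevel : ∀ {T h} → Level T h ∅ [] []
emptyLevel = record { ledger = emptyLedger ; justified = λ () ; occurs = λ () ; proper = λ { {()} } }

module _ {T h n : ℕ} {P : Presentation n} {lab out} (ℓ : Level T h P lab out) (N : Subset n) where

  private
    carried : ∀ l → Ledger T h (network (P ▷ N) (l ∷ lab))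
    carried l = enlarge {N = network P lab} (network-⊑ P lab N l) (ledger ℓ)

    module _ {l o} (L : Ledger T h (network (P ▷ N) (l ∷ lab)))
      (keeps : ∀ {m o} → Justified (carried l) m o → Justified L m o)
      (justified₀ : Justified L l o)
      (origins : ∀ {p} → p ∈ phases L → p ∈ phases (ledger ℓ) ⊎ l ≡ just (cluster p))
      (current : ∀ {c} → o ≡ coloured c → ∃[ p ] (p ∈ phases L × l ≡ just (cluster p) × c ≡ colour p
        × stage p ≡ length (Network.nbrs (network (P ▷ N) (l ∷ lab)) (cluster p))))
      where

      justified′ : ∀ v → Justified L (lookup (l ∷ lab) v) (lookup (o ∷ out) v)
      justified′ zero    = justified₀
      justified′ (suc v) = keeps (justified-enlarge {N = network P lab} (network-⊑ P lab N l) (justified ℓ v))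

      -- The edge makes the two clusters neighbours, and the newest vertex is coloured by a phase
      -- that is current now. So `distinct` applies, however old the phase of the other vertex is.
      clash : ∀ {v m o′ c} → Adj (P ▷ N) zero (suc v) → Justified L m o′ → lookup lab v ≡ m → l ≢ m →
        o ≡ coloured c → o′ ≢ coloured c
      clash {v} e (coloured q∈) v-q l≢ o≡ refl with current o≡
      ... | p , p∈ , l-p , c≡ , cur = distinct L p∈ q∈ cur
        (nbrs⁺ (P ▷ N) (l ∷ lab) ((λ eq → l≢ (trans l-p (cong just eq))) , zero , suc v , l-p , v-q , e))
        (sym c≡)

      proper′ : ∀ {u v c} → Adj (P ▷ N) u v → lookup (l ∷ lab) u ≢ lookup (l ∷ lab) v →
        lookup (o ∷ out) u ≡ coloured c → lookup (o ∷ out) v ≢ coloured c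
      proper′ {zero}  {suc v} e l≢ = clash e (justified′ (suc v)) refl l≢
      proper′ {suc u} {zero}  e l≢ u≡ v≡ = clash e (justified′ (suc u)) refl (≢-sym l≢) v≡ u≡
      proper′ {suc u} {suc v} e l≢ = proper ℓ {u} {v} e l≢

      newLevel : Level T h (P ▷ N) (l ∷ lab) (o ∷ out)
      newLevel = record
        { ledger = L ; justified = justified′
        ; occurs = λ p∈ → [ (λ p∈ → let v , eq = occurs ℓ p∈ in suc v , eq) , (λ eq → zero , eq) ]′ (origins p∈)
        ; proper = λ {u} {v} → proper′ {u} {v} }

  extendLevel : 1 ≤ T → ∀ l → T ≤ h ⊎ (1 ≤ h × (∀ v → lookup lab v ≢ l)) →
    Σ[ o ∈ Outcome ] Level T h (P ▷ N) (l ∷ lab) (o ∷ out)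
  extendLevel 1≤T nothing _ = absent , newLevel (carried nothing) (λ j → j) absent inj₁ λ ()
  extendLevel 1≤T (just a) room with T ≤? length (Network.nbrs (network (P ▷ N) (just a ∷ lab)) a)
  ... | yes large with joinRoot (carried (just a)) a 1≤T large
  ...   | L , b , F , u , ext , i , u∈F , u~ = passed b ,
          newLevel L (justified-extends ext) (passed i u∈F u~) (λ p∈ → map₂ (λ eq → cong just (sym eq)) (origin ext p∈)) λ ()
  -- By `occurs`, a label that no earlier vertex carries has no phase yet; this turns freshness of
  -- the label into `Room`.
  extendLevel 1≤T (just a) room | no small with currentPhase (carried (just a)) a (≰⇒> small)
    (map₂ (λ (1≤h , fresh) → 1≤h , λ p∈ eq → let v , v-p = occurs ℓ p∈ in fresh v (trans v-p (cong just eq))) room)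
  ...   | p , L , ext , p∈ , refl , cur = coloured (colour p) ,
          newLevel L (justified-extends ext) (coloured p∈) (λ p∈ → map₂ (λ eq → cong just (sym eq)) (origin ext p∈))
            λ { refl → p , p∈ , refl , refl , cur }

-- From one level to the next.

next : Outcome → Maybe ℕ
next (passed b) = just b
next _          = nothing

Bounded : ∀ {n} → Labelling n → ℕ → Set
Bounded lab m = ∀ v {a} → lookup lab v ≡ just a → a < m

Close : ∀ {n} → Presentation n → Labelling n → ℕ → Set
Close P lab s = ∀ u v {a} → lookup lab u ≡ just a → lookup lab v ≡ just a → Near (finalGraph P) s u v

close⇒≢ : ∀ {n} {P : Presentation n} {lab s} → Close P lab s → NoOddWalk≤ (finalGraph P) s →
  ∀ {u v a b} → Adj P u v → lookup lab u ≡ just a → lookup lab v ≡ just b → a ≢ b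
close⇒≢ {P = P} close none {u} {v} e u-a v-b refl =
  near-not-adjacent {G = finalGraph P} none (close v u v-b u-a) e

module _ {T h n : ℕ} {P : Presentation n} {lab out} (ℓ : Level T h P lab out) where

  next⁻ : ∀ v {b} → lookup (Vec.map next out) v ≡ just b → lookup out v ≡ passed b
  next⁻ v eq with lookup out v | trans (sym (lookup-map v next out)) eq
  ... | passed _ | refl = refl

  passedVia : ∀ {l o b} → Justified (ledger ℓ) l o → o ≡ passed b →
    ∃[ a ] ∃[ u ] ∃[ F ] (l ≡ just a × Indexed (roots (ledger ℓ)) b F × u ∈ F × Touch P lab a u)
  passedVia (passed i u∈ u~) refl = _ , _ , _ , refl , i , u∈ , nbrs⁻ P lab u~

  next-bounded : Bounded (Vec.map next out) (length (roots (ledger ℓ)))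
  next-bounded v eq with passedVia (justified ℓ v) (next⁻ v eq)
  ... | _ , _ , _ , _ , i , _ = indexed-< i

  -- The roots are disjoint sets of at least `T` clusters. Each of these touches another cluster, so
  -- its label is carried by some vertex and is below `m`.
  roots-few : ∀ {m} → Bounded lab m → T * length (roots (ledger ℓ)) ≤ m
  roots-few {m} lab<m = ≤-trans (total (roots-large L))
    (bounded-length (concat⁺ (roots! L) (roots-disjoint L)) λ u∈ →
      let F , u∈F , F∈ = ∈-concat⁻′ (roots L) u∈
          r , F⊆ = All.lookup (roots-local L) F∈
          _ , _ , v , _ , v-u , _ = nbrs⁻ P lab (F⊆ u∈F)
      in lab<m v v-u)
    where
    L = ledger ℓ
    total : ∀ {Fs : List (List ℕ)} → All (λ F → T ≤ length F) Fs → T * length Fs ≤ length (concat Fs)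
    total [] = ≤-reflexive (*-zeroʳ T)
    total {F ∷ Fs} (T≤ ∷ all) = begin
      T * suc (length Fs)            ≡⟨ *-suc T (length Fs) ⟩
      T + T * length Fs              ≤⟨ +-mono-≤ T≤ (total all) ⟩
      length F + length (concat Fs)  ≡⟨ length-++ F ⟨
      length (F ++ concat Fs)        ∎
      where open ≤-Reasoning

  -- Clusters a and a′ passed on to the same root r are linked by a chain a – x – r – x′ – a′.
  next-close : ∀ {s} → Close P lab s → Close P (Vec.map next out) (5 * s)
  next-close {s} close v v′ v-b v′-b
    with passedVia (justified ℓ v) (next⁻ v v-b) | passedVia (justified ℓ v′) (next⁻ v′ v′-b)
  ... | a , x , F , v-a , i , x∈ , _ , p₁ , q₁ , p₁-a , q₁-x , e₁
      | a′ , x′ , F′ , v′-a′ , i′ , x′∈ , _ , p₄ , q₄ , p₄-a′ , q₄-x′ , e₄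
    with indexed-functional i i′
  -- Both vertices were passed to the same root set `F`, and `r` is a cluster adjacent to every
  -- member of it.
  ... | refl with All.lookup (roots-local (ledger ℓ)) (indexed⇒∈ i)
  ... | r , F⊆ with nbrs⁻ P lab (F⊆ x∈) | nbrs⁻ P lab (F⊆ x′∈)
  ... | _ , p₂ , q₂ , p₂-r , q₂-x , e₂ | _ , p₃ , q₃ , p₃-r , q₃-x′ , e₃ =
    subst (λ t → Near (finalGraph P) t v v′) (five s)
      (near-trans {G = finalGraph P} (close v p₁ v-a p₁-a) e₁ (close q₁ q₂ q₁-x q₂-x) (Adj-sym P e₂)
        (near-trans {G = finalGraph P} (close p₂ p₃ p₂-r p₃-r) e₃ (close q₃ q₄ q₃-x′ q₄-x′) (Adj-sym P e₄)
          (close p₄ v′ p₄-a′ v′-a′)))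
    where
    five : ∀ s → s + (s + (s + (s + s))) ≡ 5 * s
    five = solve-∀

-- Correctness of the colours of a level.

record Good {n} (P : Presentation n) (lab : Labelling n) (col : Coloring n) (m : ℕ) : Set where
  field
    bounded  : ∀ v {a} → lookup lab v ≡ just a → lookup col v < m
    properly : ∀ {u v a b} → Adj P u v → lookup lab u ≡ just a → lookup lab v ≡ just b →
      lookup col u ≢ lookup col v

open Good

-- The level uses colours below `D` and later levels are shifted by `D`, so palettes do not meet.
-- The 0 for `absent` is a dummy: `Good` speaks of labelled vertices only.
paint : ℕ → Outcome → ℕ → ℕ
paint D absent       _ = 0
paint D (coloured c) _ = c
paint D (passed _)   d = D + d

module _ {T h n : ℕ} {P : Presentation n} {lab out} (ℓ : Level T h P lab out)
  {D : ℕ} (T*h≤D : T * h ≤ D) (col : Coloring n) where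

  private
    data Painted (v : Fin n) : ℕ → Set where
      here  : ∀ {c} → lookup out v ≡ coloured c → c < D → Painted v c
      above : ∀ {b} → lookup (Vec.map next out) v ≡ just b → Painted v (D + lookup col v)

    painted : ∀ v {a} → lookup lab v ≡ just a → Painted v (lookup (zipWith (paint D) out col) v)
    painted v v-a = subst (Painted v) (sym (lookup-zipWith (paint D) v out col)) (view v-a)
      where
      view : ∀ {a} → lookup lab v ≡ just a → Painted v (paint D (lookup out v) (lookup col v))
      view v-a with lookup out v in eq | lookup lab v | justified ℓ v
      view refl | _ | _ | coloured p∈  = here eq (≤-trans (colour< (ledger ℓ) p∈) T*h≤D)
      view refl | _ | _ | passed _ _ _ = above (trans (lookup-map v next out) (cong next eq))

  -- Two colours of this level differ by `proper`, as no edge lies inside a cluster; two later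
  -- colours differ by `good`; in the mixed case the palettes are disjoint.
  level-good : ∀ {s m} → Close P lab s → NoOddWalk≤ (finalGraph P) s →
    Good P (Vec.map next out) col m → Good P lab (zipWith (paint D) out col) (D + m)
  level-good {s} {m} close none good = record { bounded = bounded′ ; properly = properly′ }
    where
    bounded′ : ∀ v {a} → lookup lab v ≡ just a → lookup (zipWith (paint D) out col) v < D + m
    bounded′ v v-a with lookup (zipWith (paint D) out col) v | painted v v-a
    ... | _ | here _ c<D = ≤-trans c<D (m≤m+n D m)
    ... | _ | above v-b  = +-monoʳ-< D (bounded good v v-b)
    properly′ : ∀ {u v a b} → Adj P u v → lookup lab u ≡ just a → lookup lab v ≡ just b →
      lookup (zipWith (paint D) out col) u ≢ lookup (zipWith (paint D) out col) v
    properly′ {u} {v} e u-a v-b eq with lookup (zipWith (paint D) out col) u | painted u u-a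
        | lookup (zipWith (paint D) out col) v | painted v v-b
    ... | _ | here u-c _   | _ | here v-c _   = proper ℓ e
          (λ eq′ → close⇒≢ {P = P} {lab} close none e u-a v-b (just-injective (trans (sym u-a) (trans eq′ v-b))))
          u-c (trans v-c (cong coloured (sym eq)))
    ... | _ | here _ c<D   | _ | above _      = <⇒≱ c<D (≤-trans (m≤m+n D _) (≤-reflexive (sym eq)))
    ... | _ | above _      | _ | here _ c<D   = <⇒≱ c<D (≤-trans (m≤m+n D _) (≤-reflexive eq))
    ... | _ | above u-next | _ | above v-next = properly good e u-next v-next (+-cancelˡ-≡ D _ _ eq)

-- The whole algorithm

-- The top uses the label itself as colour, with dummy 0 for unlabelled vertices. In a storey `T`
-- and `h` are both `x`, which costs `x * x` colours.
data Tower (x : ℕ) : ℕ → ∀ {n} → Presentation n → Labelling n → Coloring n → Set where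
  top   : ∀ {n} {P : Presentation n} {lab} → Tower x 0 P lab (Vec.map (fromMaybe 0) lab)
  storey : ∀ {k n} {P : Presentation n} {lab out col} → Level x x P lab out →
    Tower x k P (Vec.map next out) col → Tower x (suc k) P lab (zipWith (paint (x * x)) out col)

emptyTower : ∀ {x} k → Tower x k ∅ [] []
emptyTower zero    = top
emptyTower (suc k) = storey emptyLevel (emptyTower k)

extendTower : ∀ {x k n} {P : Presentation n} {lab col} → 1 ≤ x → Tower x k P lab col → ∀ N l →
  Σ[ c ∈ ℕ ] Tower x k (P ▷ N) (l ∷ lab) (c ∷ col)
extendTower 1≤x top N l = fromMaybe 0 l , top
extendTower {x} 1≤x (storey ℓ t) N l with extendLevel ℓ N 1≤x l (inj₁ ≤-refl)
... | o , ℓ′ with extendTower 1≤x t N (next o)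
...   | c , t′ = paint (x * x) o c , storey ℓ′ t′

-- Each storey divides the bound on labels by `x` and multiplies the walk bound by 5, so both
-- hypotheses on `m` and `s` carry over to `k`. At the top at most `x * x` labels are left.
tower-good : ∀ {x k n} {P : Presentation n} {lab col m s S} → 1 ≤ x → Tower x k P lab col →
  Bounded lab m → m ≤ x ^ k * (x * x) →
  Close P lab s → s * 5 ^ k ≤ S → NoOddWalk≤ (finalGraph P) S →
  Good P lab col (suc k * (x * x))
tower-good {x} {P = P} {lab} {s = s} {S} 1≤x top lab<m m≤ close s≤ none = record
  { bounded = λ v v-a → <-≤-trans (subst (_< _) (sym (at v v-a)) (lab<m v v-a)) m≤
  ; properly = λ {u} {v} e u-a v-b eq → close⇒≢ {P = P} {lab} close none′ e u-a v-b
      (trans (sym (at u u-a)) (trans eq (at v v-b))) }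
  where
  at : ∀ v {a} → lookup lab v ≡ just a → lookup (Vec.map (fromMaybe 0) lab) v ≡ a
  at v v-a = trans (lookup-map v (fromMaybe 0) lab) (cong (fromMaybe 0) v-a)
  none′ : NoOddWalk≤ (finalGraph P) s
  none′ p odd ℓ≤ = none p odd (≤-trans ℓ≤ (≤-trans (≤-reflexive (sym (*-identityʳ s))) s≤))
tower-good {x} {suc k} {P = P} {lab} {m = m} {s} {S} 1≤x (storey {out = out} {col} ℓ t) lab<m m≤ close s≤ none =
  level-good ℓ ≤-refl col close (λ p odd ℓ≤ → none p odd (≤-trans ℓ≤ (≤-trans (m≤m*n s (5 ^ suc k) ⦃ m^n≢0 5 (suc k) ⦄) s≤)))
    (tower-good 1≤x t (next-bounded ℓ) roots≤ (next-close ℓ close) (≤-trans (≤-reflexive (eq s (5 ^ k))) s≤) none)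
  where
  eq : ∀ s t → 5 * s * t ≡ s * (5 * t)
  eq = solve-∀
  roots≤ : length (roots (ledger ℓ)) ≤ x ^ k * (x * x)
  roots≤ = *-cancelˡ-≤ x ⦃ >-nonZero 1≤x ⦄
    (≤-trans (roots-few ℓ lab<m) (≤-trans m≤ (≤-reflexive (*-assoc x (x ^ k) (x * x)))))

-- Level 0, where every vertex is a cluster.

stamps : ∀ n → Labelling n
stamps zero    = []
stamps (suc n) = just n ∷ stamps n

stamped : ∀ {n} (v : Fin n) → ∃[ a ] lookup (stamps n) v ≡ just a
stamped {suc n} zero    = n , refl
stamped {suc n} (suc v) = stamped v

stamps-bounded : ∀ n → Bounded (stamps n) n
stamps-bounded (suc n) zero    refl = ≤-refl
stamps-bounded (suc n) (suc v) eq   = m≤n⇒m≤1+n (stamps-bounded n v eq)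

stamps-fresh : ∀ {n} v → lookup (stamps n) v ≢ just n
stamps-fresh {n} v eq = <-irrefl refl (stamps-bounded n v eq)

stamps-injective : ∀ {n} u v {a} → lookup (stamps n) u ≡ just a → lookup (stamps n) v ≡ just a → u ≡ v
stamps-injective {suc n} zero    zero    _    _  = refl
stamps-injective {suc n} zero    (suc v) refl eq = contradiction eq (stamps-fresh v)
stamps-injective {suc n} (suc u) zero    eq refl = contradiction eq (stamps-fresh u)
stamps-injective {suc n} (suc u) (suc v) p    q  = cong suc (stamps-injective u v p q)

stamps-close : ∀ {n} {P : Presentation n} → Close P (stamps n) 1
stamps-close u v u-a v-a with stamps-injective u v u-a v-a
... | refl = 0 , [] , divides 0 refl , z<s

-- At the ground level `T` is `x * x` and `h` is 1, since a single-vertex cluster needs just one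
-- colour; this again costs `x * x` colours.
record Colouring (x k : ℕ) {n : ℕ} (P : Presentation n) : Set where
  field
    {outcomes} : Vec Outcome n
    {upper}    : Coloring n
    ground     : Level (x * x) 1 P (stamps n) outcomes
    tower      : Tower x k P (Vec.map next outcomes) upper

  colours : Coloring n
  colours = zipWith (paint (x * x)) outcomes upper

open Colouring

colouring : ∀ {x} → 1 ≤ x → ∀ k {n} (P : Presentation n) → Colouring x k P
colouring 1≤x k ∅ = record { ground = emptyLevel ; tower = emptyTower k }
colouring 1≤x k {suc n} (P ▷ N) =
  let C     = colouring 1≤x k P
      o , ℓ = extendLevel (ground C) N (*-mono-≤ 1≤x 1≤x) (just n) (inj₂ (≤-refl , stamps-fresh))
      _ , t = extendTower 1≤x (tower C) N (next o)
  in record { ground = ℓ ; tower = t }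

-- The exponent `4 + k` consists of 2 for the ground level, `k` for the storeys and 2 for the labels
-- left at the top. Walk bounds grow from 1 to `5 ^ suc k`.
colouring-good : ∀ {x k n} {P : Presentation n} → 1 ≤ x → n ≤ x ^ (4 + k) →
  NoOddWalk≤ (finalGraph P) (5 ^ suc k) → (C : Colouring x k P) →
  Good P (stamps n) (colours C) ((2 + k) * (x * x))
colouring-good {x} {k} {n} {P} 1≤x n≤ none C =
  level-good (ground C) (≤-reflexive (*-identityʳ (x * x))) (upper C) (stamps-close {P = P})
    (λ p odd ℓ≤ → none p odd (≤-trans ℓ≤ (m^n>0 5 (suc k))))
    (tower-good 1≤x (tower C) (next-bounded (ground C)) roots≤
      (next-close (ground C) (stamps-close {P = P})) ≤-refl none)
  where
  eq : ∀ x y → x * (x * (x * (x * y))) ≡ x * x * (y * (x * x))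
  eq = solve-∀
  roots≤ : length (roots (ledger (ground C))) ≤ x ^ k * (x * x)
  roots≤ = *-cancelˡ-≤ (x * x) ⦃ >-nonZero (*-mono-≤ 1≤x 1≤x) ⦄
    (≤-trans (roots-few (ground C) (stamps-bounded n)) (≤-trans n≤ (≤-reflexive (eq x (x ^ k)))))

good⇒proper : ∀ {n} {P : Presentation n} {col m} → Good P (stamps n) col m → Proper (finalGraph P) col
good⇒proper good {u} {v} e = properly good e (proj₂ (stamped u)) (proj₂ (stamped v))

good⇒colorsUsed : ∀ {n} {P : Presentation n} {col m} → Good P (stamps n) col m → colorsUsed col ≤ m
good⇒colorsUsed {col = col} {m} good = bounded-length (deduplicate-! (toList col)) λ c∈ →
  let c∈col = ∈-toList⁻ (∈-deduplicate⁻ _≟_ (toList col) c∈)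
      v     = index c∈col
  in subst (_< m) (sym (lookup-index c∈col)) (bounded good v (proj₂ (stamped v)))

-- The online algorithm and the number of its colours.

root : ∀ k n → ∃[ x ] (1 ≤ x × suc n ≤ x ^ (4 + k) × x ^ (4 + k) ≤ 2 ^ (4 + k) * suc n)
root k n = integerRoot (4 + k) n (s≤s z≤n)

-- The state is rebuilt from the presentation at every step. Rebuilding is deterministic and extends
-- the state of the previous step, so old colours reappear unchanged. `pred` is there because
-- `integerRoot` speaks of `suc n`.
algorithm : ℕ → OnlineAlgorithm
algorithm k n P _ = Vec.head (colours (colouring (proj₁ (proj₂ (root k (pred n)))) k P))

run-algorithm : ∀ k n {i} (P : Presentation i) →
  run (algorithm k) n P ≡ colours (colouring (proj₁ (proj₂ (root k (pred n)))) k P)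
run-algorithm k n ∅       = refl
run-algorithm k n (P ▷ N) = cong (algorithm k n (P ▷ N) (run (algorithm k) n P) ∷_) (run-algorithm k n P)

-- Twice `5 ^ suc k + 1` is `10 * 5 ^ k + 2`, which falls short of the numerator by `5 ^ k + 1`.
5^<girth : ∀ k → 5 ^ suc k < (11 * 5 ^ k + 3) / 2
5^<girth k = subst (_≤ (11 * 5 ^ k + 3) / 2) (m*n/n≡m (suc (5 ^ suc k)) 2) (/-monoˡ-≤ 2 (begin
  suc (5 * 5 ^ k) * 2            ≤⟨ m≤m+n _ (5 ^ k + 1) ⟩
  suc (5 * 5 ^ k) * 2 + (5 ^ k + 1) ≡⟨ eq (5 ^ k) ⟩
  11 * 5 ^ k + 3                 ∎))
  where
  open ≤-Reasoning
  eq : ∀ t → suc (5 * t) * 2 + (t + 1) ≡ 11 * t + 3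
  eq = solve-∀

-- The constant 8 is 2 from `2 + k ≤ 2 * (k + 1)` times 4 from using the root bound for both factors
-- of `x * x`.
colour-count : ∀ {m x n} k q → m ≤ (2 + k) * (x * x) → x ^ q ≤ 2 ^ q * n →
  m ^ q ≤ (8 * (k + 1)) ^ q * n ^ 2
colour-count {m} {x} {n} k q m≤ x≤ = begin
  m ^ q                                       ≤⟨ ^-monoˡ-≤ q m≤ ⟩
  ((2 + k) * (x * x)) ^ q                     ≡⟨ ^-distribʳ-* q (2 + k) (x * x) ⟩
  (2 + k) ^ q * (x * x) ^ q                   ≡⟨ cong ((2 + k) ^ q *_) (^-distribʳ-* q x x) ⟩
  (2 + k) ^ q * (x ^ q * x ^ q)               ≤⟨ *-mono-≤ (^-monoˡ-≤ q k≤) (*-mono-≤ x≤ x≤) ⟩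
  (2 * (k + 1)) ^ q * (2 ^ q * n * (2 ^ q * n)) ≡⟨ regroup ((2 * (k + 1)) ^ q) (2 ^ q) n ⟩
  (2 * (k + 1)) ^ q * (2 ^ q * 2 ^ q) * n ^ 2 ≡⟨ cong (λ y → (2 * (k + 1)) ^ q * y * n ^ 2) (^-distribʳ-* q 2 2) ⟨
  (2 * (k + 1)) ^ q * 4 ^ q * n ^ 2           ≡⟨ cong (_* n ^ 2) (^-distribʳ-* q (2 * (k + 1)) 4) ⟨
  (2 * (k + 1) * 4) ^ q * n ^ 2               ≡⟨ cong (λ y → y ^ q * n ^ 2) (eight (k + 1)) ⟩
  (8 * (k + 1)) ^ q * n ^ 2                   ∎
  where
  open ≤-Reasoning
  k≤ : 2 + k ≤ 2 * (k + 1)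
  k≤ = ≤-trans (m≤m+n (2 + k) k) (≤-reflexive (eq k))
    where
    eq : ∀ k → 2 + k + k ≡ 2 * (k + 1)
    eq = solve-∀
  regroup : ∀ a b n → a * (b * n * (b * n)) ≡ a * (b * b) * (n * (n * 1))
  regroup = solve-∀
  eight : ∀ y → 2 * y * 4 ≡ 8 * y
  eight = solve-∀

theorem23 : Σ[ C ∈ ℕ ] ((k : ℕ) →
    Σ[ A ∈ OnlineAlgorithm ] ((n : ℕ) → n ≥ 1 → (P : Presentation n) →
    OddGirth≥ (finalGraph P) ((11 * 5 ^ k + 3) / 2) →
    Proper (finalGraph P) (run A n P)
    × colorsUsed (run A n P) ≤ C * (k + 1) · n ^⟨ 2 / (4 + k) ⟩))
theorem23 = 8 , λ k → algorithm k , λ where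
  (suc n) _ P girth →
    let x , 1≤x , n≤ , x≤ = root k n
        good = subst (λ c → Good P (stamps (suc n)) c ((2 + k) * (x * x))) (sym (run-algorithm k (suc n) P))
                 (colouring-good {x} 1≤x n≤ (oddGirth⇒noOddWalk {G = finalGraph P} girth (5^<girth k)) (colouring 1≤x k P))
    in good⇒proper {P = P} good , colour-count {x = x} k (4 + k) (good⇒colorsUsed {P = P} good) x≤
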